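{- For any integer $n \geq 1$, $$\iota(n,K_3) = \iota(B_{n,K_3}, K_3) = \left\lfloor \frac{n}{4} \right\rfloor.$$
   Context: All graphs are finite and simple. For a graph $G$ and $v \in V(G)$, $N[v]$ is the set consisting of $v$ and its neighbours; for $D \subseteq V(G)$, $N[D] = \bigcup_{v \in D} N[v]$, and $G - N[D]$ is the subgraph of $G$ induced by $V(G) \setminus N[D]$. A set $D \subseteq V(G)$ is a $\{K_3\}$-isolating set of $G$ if $G - N[D]$ contains no triangle (no subgraph isomorphic to $K_3$). $\iota(G,K_3)$ denotes the size of a smallest $\{K_3\}$-isolating set of $G$. For an integer $n \geq 1$, $[n] = \{1,\dots,n\}$, and $\iota(n,K_3)$ denotes the maximum of $\iota(G,K_3)$ over all connected graphs $G$ with $V(G) = [n]$ and $G \not\simeq K_3$. $P_m$ denotes the path with vertex set $[m]$ and edges $\{i,i+1\}$, $1 \le i \le m-1$. The graph $B_{n,K_3}$ is defined as follows. If $n \leq 3$, then $B_{n,K_3} = P_n$. If $n \geq 4$, let $a = \lfloor n/4 \rfloor$ and $b = n - 3a$ (so $a \le b \le a+3$). Let $P^*$ be the graph with vertex set $[b]$ and edge set $E(P_a) \cup \{\{a,i\} \colon i \in [b] \setminus [a]\}$. Take copies $F_1, \dots, F_a$ of $K_3$ that are vertex-disjoint from each other and from $P^*$. Then $B_{n,K_3}$ is the connected $n$-vertex graph obtained from the union of $P^*, F_1, \dots, F_a$ by joining, for each $i \in [a]$, the vertex $i$ of $P^*$ to every vertex of $F_i$. -}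

module Defs where

open import Data.Nat
  using (ℕ; zero; suc; _+_; _*_; _∸_; _≤_; _<_; z≤n; s≤s; _≤?_; _<?_; _/_)
import Data.Nat.Properties as ℕ
open import Data.Nat.DivMod using (m/n*n≤m)
open import Data.Fin using (Fin; zero; suc; toℕ; cast; splitAt; remQuot)
open import Data.Fin.Properties using (_≟_; any?)
open import Data.Fin.Subset using (Subset; _∈_; ∁; ⊤; ∣_∣)
open import Data.Fin.Subset.Properties
  using (_∈?_; ∈⊤; x∈∁p⇒x∉p; ∣⊤∣≡n; anySubset?)
open import Data.Vec using (tabulate)
open import Data.Vec.Properties using (lookup∘tabulate; lookup⇒[]=)
open import Data.Product using (Σ; ∃; _×_; _,_; proj₁; proj₂)
open import Data.Sum using (_⊎_; inj₁; inj₂; map₂)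
open import Data.Empty using (⊥; ⊥-elim)
open import Function using (_∘_)
open import Function.Bundles using (_⇔_; _↔_; Inverse)
open import Function.Definitions using (Injective)
open import Level using (Level; 0ℓ)
open import Relation.Binary.Core using (Rel)
open import Relation.Binary.Definitions
  using (Symmetric; Irreflexive) renaming (Decidable to Decidable₂)
open import Relation.Binary.Construct.Closure.ReflexiveTransitive using (Star)
open import Relation.Binary.Construct.Closure.Symmetric as Sym
  using (SymClosure; fwd; bwd)
open import Relation.Binary.PropositionalEquality
  using (_≡_; _≢_; refl; sym; trans; cong)
open import Relation.Nullary using (¬_; Dec; yes; no; does)
open import Relation.Nullary.Decidable
  using (_×-dec_; _⊎-dec_; ¬?; map′; dec-true)
open import Relation.Unary using (Pred; Decidable)

private
  variable
    ℓ : Level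
    n : ℕ
    V W : Set

record Graph (V : Set) : Set₁ where
  infix 4 _~_ _~?_
  field
    _~_    : Rel V 0ℓ
    symm   : Symmetric _~_
    irrefl : Irreflexive _≡_ _~_
    _~?_   : Decidable₂ _~_

open Graph public using () renaming (_~_ to Adj)

-- The graph whose edges are the pairs {u , v} with E u v.
fromEdges : (E : Rel V 0ℓ) → Irreflexive _≡_ E → Decidable₂ E → Graph V
fromEdges E E-irrefl E? = record
  { _~_    = SymClosure E
  ; symm   = Sym.symmetric E
  ; irrefl = λ { refl (fwd e) → E-irrefl refl e
               ; refl (bwd e) → E-irrefl refl e }
  ; _~?_   = λ u v → map′ (λ { (inj₁ e) → fwd e ; (inj₂ e) → bwd e })
                          (λ { (fwd e) → inj₁ e ; (bwd e) → inj₂ e })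
                          (E? u v ⊎-dec E? v u)
  }

pullback : (V → W) → Graph W → Graph V
pullback f G = record
  { _~_    = λ u v → f u ~ f v
  ; symm   = symm
  ; irrefl = λ eq → irrefl (cong f eq)
  ; _~?_   = λ u v → f u ~? f v
  } where open Graph G

-- Membership x ∈ S is proof-irrelevant, so the vertices of the induced
-- subgraph are exactly the elements of S.
induced : Graph (Fin n) → (S : Subset n) → Graph (Σ (Fin n) (_∈ S))
induced G S = pullback proj₁ G

K : (k : ℕ) → Graph (Fin k)
K k = record
  { _~_    = _≢_
  ; symm   = λ u≢v v≡u → u≢v (sym v≡u)
  ; irrefl = λ u≡v u≢v → u≢v u≡v
  ; _~?_   = λ u v → ¬? (u ≟ v)
  }

Connected : Graph V → Set
Connected G = ∀ u v → Star (Adj G) u v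

infix 4 _≅_

_≅_ : Graph V → Graph W → Set
_≅_ {V} {W} G H =
  Σ (V ↔ W) λ f → ∀ u v → Adj G u v ⇔ Adj H (Inverse.to f u) (Inverse.to f v)

-- G has a (not necessarily induced) subgraph isomorphic to F.
Contains : Graph V → Graph W → Set
Contains {V} {W} G F =
  Σ (W → V) λ f → Injective _≡_ _≡_ f × (∀ {u v} → Adj F u v → Adj G (f u) (f v))

comprehension : {P : Pred (Fin n) ℓ} → Decidable P → Subset n
comprehension P? = tabulate (λ v → does (P? v))

∈-comprehension : {P : Pred (Fin n) ℓ} (P? : Decidable P) →
                  ∀ {v} → P v → v ∈ comprehension P?
∈-comprehension P? {v} p =
  lookup⇒[]= v _ (trans (lookup∘tabulate _ v) (dec-true (P? v) p))

module _ (G : Graph (Fin n)) where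
  open Graph G

  ∈N[v]? : (v : Fin n) → Decidable (λ u → u ≡ v ⊎ v ~ u)
  ∈N[v]? v u = (u ≟ v) ⊎-dec (v ~? u)

  N[v] : Fin n → Subset n
  N[v] v = comprehension (∈N[v]? v)

  ∈N[D]? : (D : Subset n) → Decidable (λ u → ∃ λ v → v ∈ D × u ∈ N[v] v)
  ∈N[D]? D u = any? (λ v → (v ∈? D) ×-dec (u ∈? N[v] v))

  N[D] : Subset n → Subset n
  N[D] D = comprehension (∈N[D]? D)

  G-N[_] : (D : Subset n) → Graph (Σ (Fin n) (_∈ ∁ (N[D] D)))
  G-N[ D ] = induced G (∁ (N[D] D))

  IsK₃Isolating : Subset n → Set
  IsK₃Isolating D = ¬ Contains G-N[ D ] (K 3)

  containsK₃? : (S : Subset n) → Dec (Contains (induced G S) (K 3))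
  containsK₃? S = map′ to from
    (any? λ x → any? λ y → any? λ z →
      (x ∈? S ×-dec y ∈? S ×-dec z ∈? S) ×-dec (x ~? y ×-dec x ~? z ×-dec y ~? z))
    where
    to : _ → Contains (induced G S) (K 3)
    to (x , y , z , (x∈ , y∈ , z∈) , (xy , xz , yz)) =
      f , (λ {i} {j} → inj i j) , (λ {i} {j} → hom i j)
      where
      f : Fin 3 → Σ (Fin n) (_∈ S)
      f zero             = x , x∈
      f (suc zero)       = y , y∈
      f (suc (suc zero)) = z , z∈

      hom : ∀ i j → i ≢ j → proj₁ (f i) ~ proj₁ (f j)
      hom zero             zero             i≢j = ⊥-elim (i≢j refl)
      hom zero             (suc zero)       _   = xy
      hom zero             (suc (suc zero)) _   = xz
      hom (suc zero)       zero             _   = symm xy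
      hom (suc zero)       (suc zero)       i≢j = ⊥-elim (i≢j refl)
      hom (suc zero)       (suc (suc zero)) _   = yz
      hom (suc (suc zero)) zero             _   = symm xz
      hom (suc (suc zero)) (suc zero)       _   = symm yz
      hom (suc (suc zero)) (suc (suc zero)) i≢j = ⊥-elim (i≢j refl)

      inj : ∀ i j → f i ≡ f j → i ≡ j
      inj i j eq with i ≟ j
      ... | yes i≡j = i≡j
      ... | no  i≢j = ⊥-elim (irrefl (cong proj₁ eq) (hom i j i≢j))

    from : Contains (induced G S) (K 3) → _
    from (f , _ , hom) =
      proj₁ (f zero) , proj₁ (f (suc zero)) , proj₁ (f (suc (suc zero))) ,
      (proj₂ (f zero) , proj₂ (f (suc zero)) , proj₂ (f (suc (suc zero)))) ,
      (hom (λ ()) , hom (λ ()) , hom (λ ()))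

  ⊤-isolating : IsK₃Isolating ⊤
  ⊤-isolating (f , _) = x∈∁p⇒x∉p (proj₂ (f zero))
    (∈-comprehension (∈N[D]? ⊤)
      (proj₁ (f zero) , ∈⊤ , ∈-comprehension (∈N[v]? (proj₁ (f zero))) (inj₁ refl)))

IsMinimum : Pred ℕ ℓ → ℕ → Set ℓ
IsMinimum P m = P m × (∀ k → P k → m ≤ k)

IsMaximum : Pred ℕ ℓ → ℕ → Set ℓ
IsMaximum P m = P m × (∀ k → P k → k ≤ m)

minimum : {P : Pred ℕ ℓ} → Decidable P → ∀ m → P m → ∃ (IsMinimum P)
minimum P? m p with P? 0
... | yes p₀ = 0 , p₀ , λ _ _ → z≤n
minimum P? zero    p | no ¬p₀ = ⊥-elim (¬p₀ p)
minimum P? (suc m) p | no ¬p₀ with minimum (P? ∘ suc) m p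
... | k , pk , least = suc k , pk , λ
  { zero    p₀ → ⊥-elim (¬p₀ p₀)
  ; (suc j) pj → s≤s (least j pj)
  }

K₃IsolatingSize : Graph (Fin n) → Pred ℕ 0ℓ
K₃IsolatingSize {n} G k = ∃ λ (D : Subset n) → ∣ D ∣ ≡ k × IsK₃Isolating G D

smallest : (G : Graph (Fin n)) → ∃ (IsMinimum (K₃IsolatingSize G))
smallest {n} G = minimum
  (λ k → anySubset? λ D → (∣ D ∣ ℕ.≟ k) ×-dec ¬? (containsK₃? G (∁ (N[D] G D))))
  n (⊤ , ∣⊤∣≡n n , ⊤-isolating G)

ι : Graph (Fin n) → ℕ
ι G = proj₁ (smallest G)

-- "ι(n , K₃) = m".  The maximum is specified by a relation because the graphs
-- on Fin n form a type with no direct enumeration.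
IsιMax : ℕ → ℕ → Set₁
IsιMax n = IsMaximum λ k →
  ∃ λ (G : Graph (Fin n)) → Connected G × ¬ (G ≅ K 3) × ι G ≡ k

-- Vertex i of the informal [m] is the element of Fin m
-- with toℕ equal to i ∸ 1.

Path : (m : ℕ) → Graph (Fin m)
Path m = fromEdges (λ i j → suc (toℕ i) ≡ toℕ j)
                   (λ { refl → ℕ.1+n≢n })
                   (λ i j → suc (toℕ i) ℕ.≟ toℕ j)

-- First summand: the path on the first a vertices; second
-- summand: the last path vertex joined to all vertices beyond it.
P*Edge : (a b : ℕ) → Rel (Fin b) 0ℓ
P*Edge a b i j = (suc (toℕ i) ≡ toℕ j × toℕ j < a)
               ⊎ (suc (toℕ i) ≡ a × a ≤ toℕ j)

P* : (a b : ℕ) → Graph (Fin b)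
P* a b = fromEdges (P*Edge a b) irr
  (λ i j → ((suc (toℕ i) ℕ.≟ toℕ j) ×-dec (toℕ j <? a))
     ⊎-dec ((suc (toℕ i) ℕ.≟ a) ×-dec (a ≤? toℕ j)))
  where
  irr : Irreflexive _≡_ (P*Edge a b)
  irr refl (inj₁ (eq , _))    = ℕ.1+n≢n eq
  irr refl (inj₂ (refl , le)) = ℕ.1+n≰n le

-- inj₂ (k , x) is vertex x of the copy F k of K₃.
BEdge : (a b : ℕ) → Rel (Fin b ⊎ (Fin a × Fin 3)) 0ℓ
BEdge a b (inj₁ i)       (inj₁ j)       = Adj (P* a b) i j
BEdge a b (inj₁ i)       (inj₂ (k , _)) = toℕ i ≡ toℕ k
BEdge a b (inj₂ _)       (inj₁ _)       = ⊥
BEdge a b (inj₂ (k , x)) (inj₂ (l , y)) = k ≡ l × Adj (K 3) x y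

B⊎ : (a b : ℕ) → Graph (Fin b ⊎ (Fin a × Fin 3))
B⊎ a b = fromEdges (BEdge a b) irr dec
  where
  irr : Irreflexive _≡_ (BEdge a b)
  irr {inj₁ i} refl e         = Graph.irrefl (P* a b) refl e
  irr {inj₂ _} refl (_ , x≢x) = x≢x refl

  dec : Decidable₂ (BEdge a b)
  dec (inj₁ i)       (inj₁ j)       = Graph._~?_ (P* a b) i j
  dec (inj₁ i)       (inj₂ (k , _)) = toℕ i ℕ.≟ toℕ k
  dec (inj₂ _)       (inj₁ _)       = no λ ()
  dec (inj₂ (k , x)) (inj₂ (l , y)) = (k ≟ l) ×-dec ¬? (x ≟ y)

-- The bijection numbering the vertices of P* and of the triangles by Fin n,
-- where a = ⌊n/4⌋ and b = n ∸ 3a.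
module _ (n : ℕ) where
  private
    a b : ℕ
    a = n / 4
    b = n ∸ a * 3

    n≡b+3a : n ≡ b + a * 3
    n≡b+3a = sym (ℕ.m∸n+n≡m
      (ℕ.≤-trans (ℕ.*-monoʳ-≤ a (ℕ.n≤1+n 3)) (m/n*n≤m n 4)))

  decode : Fin n → Fin b ⊎ (Fin a × Fin 3)
  decode v = map₂ (remQuot 3) (splitAt b (cast n≡b+3a v))

B : (n : ℕ) → Graph (Fin n)
B n with n ≤? 3
... | yes _ = Path n
... | no  _ = pullback (decode n) (B⊎ (n / 4) (n ∸ n / 4 * 3))

-- Upper bound. Call a triangle of G[S] bad if it is a whole component of G[S].
-- By induction on |S|, a set S without bad triangles has an isolating set of
-- size at most |S|/4. Unless S has no triangle, it has a vertex v with at least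
-- three neighbours; remove N[v]. If this creates no bad triangle, recurse.
-- Otherwise a bad triangle T = ypq of S - N[v] has, say, y adjacent to some
-- x in N(v), and unless v lies in a bad triangle vrs of S - N[y], there are
-- strictly fewer bad vertices in S - N[y] than in S - N[v], so v is replaced by
-- y. When no such replacement exists, x touches every bad triangle of S - N[v];
-- {v, x} then serves for N[v] and all these triangles as soon as they have
-- together at least 8 vertices. The remaining case is N[v] = {v, r, s, x} with T
-- the only bad triangle, where one of r, s, p, q, x serves.
--
-- Lower bound. An isolating set of B n meets each of the n/4 disjoint sets
-- {i} ∪ V(F i).
{-# OPTIONS --safe #-}

module Submission where

open import Defs
open import Data.Empty as Empty using (⊥-elim)
open import Data.Fin
  using (Fin; zero; suc; toℕ; fromℕ<; inject₁; inject≤; cast; join; splitAt; remQuot; combine)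
open import Data.Fin.Permutation using (↔⇒≡)
open import Data.Fin.Properties
  using (_≟_; any?; all?; toℕ-fromℕ<; toℕ-inject₁; toℕ-inject≤; toℕ-injective; cast-involutive;
         splitAt-join; join-splitAt; remQuot-combine; combine-remQuot)
open import Data.Fin.Subset
  using (Subset; inside; outside; _∈_; _∉_; _⊆_; ∣_∣; ⁅_⁆; _∪_; ∁; ⊥; ⊤)
open import Data.Fin.Subset.Properties
  using (_∈?_; p⊆q⇒∣p∣≤∣q∣; p⊂q⇒∣p∣<∣q∣; x∈p∧x≢y⇒x∈p-y; x∈p⇒∣p-x∣<∣p∣; ∣⊥∣≡0; ∣⊤∣≡n;
         ∪-identityˡ; x∈⁅x⁆; x∈p∪q⁺; ∈⊤; ∉⊥; x∈∁p⇒x∉p; x∉p⇒x∈∁p)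
open import Data.List using (List; []; _∷_; _++_; length; tabulate)
open import Data.List.Membership.DecPropositional using () renaming (_∈?_ to memberBy)
open import Data.List.Membership.Propositional using () renaming (_∈_ to _∈ˡ_; _∉_ to _∉ˡ_)
open import Data.List.Properties using (length-++; length-tabulate)
open import Data.List.Relation.Unary.All as All using (All; []; _∷_)
import Data.List.Relation.Unary.All.Properties as AllP
open import Data.List.Relation.Unary.AllPairs using ([]; _∷_)
open import Data.List.Relation.Unary.Any using (here; there)
open import Data.List.Relation.Unary.Unique.Propositional using (Unique)
import Data.List.Relation.Unary.Unique.Propositional.Properties as Unique
open import Data.Nat
  using (ℕ; zero; suc; _+_; _*_; _∸_; _≤_; _<_; _/_; z≤n; s≤s; _≤?_; _<?_)
open import Data.Nat.DivMod using (m*n/n≡m; /-monoˡ-≤; m/n*n≤m; m<n⇒m/n≡0; m≥n⇒m/n>0)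
open import Data.Nat.Induction using (<-wellFounded)
import Data.Nat.Properties as ℕ
open import Data.Product using (Σ; ∃; ∃₂; _×_; _,_; proj₁; proj₂; uncurry)
open import Data.Product.Properties using (,-injectiveʳ)
open import Data.Sum using (_⊎_; inj₁; inj₂; [_,_]′; swap; map₂)
open import Data.Sum.Properties using (inj₂-injective)
open import Data.Vec using (_∷_)
open import Data.Vec.Properties using (lookup∘tabulate; []=⇒lookup)
open import Function using (_∘_; case_of_)
open import Function.Bundles using (Equivalence; Inverse; mk↔ₛ′; mk⇔)
open import Function.Definitions using (Injective)
open import Induction.WellFounded using (Acc; acc)
open import Level using (Level)
open import Relation.Binary.Construct.Closure.ReflexiveTransitive
  using (Star; ε; _◅_; _◅◅_; gmap; reverse)
open import Relation.Binary.Construct.Closure.Symmetric using (fwd; bwd)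
open import Relation.Binary.PropositionalEquality
  using (_≡_; _≢_; refl; sym; trans; cong; subst; subst₂)
open import Relation.Nullary using (¬_; Dec; yes; no; does)
open import Relation.Nullary.Decidable using (_×-dec_; _⊎-dec_; _→-dec_; ¬?; map′)
open import Relation.Unary using (Pred; Decidable)

private
  variable
    ℓ : Level
    n : ℕ

-- Subsets of `Fin n` and duplicate-free lists.

_∈ˡ?_ : (v : Fin n) (vs : List (Fin n)) → Dec (v ∈ˡ vs)
_∈ˡ?_ = memberBy _≟_

∈-comprehension⁻ : {P : Pred (Fin n) ℓ} (P? : Decidable P) →
                   ∀ {v} → v ∈ comprehension P? → P v
∈-comprehension⁻ P? {v} v∈
  with P? v | trans (sym (lookup∘tabulate (does ∘ P?) v)) ([]=⇒lookup v∈)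
... | yes p | _ = p
... | no _  | ()

-- The counting tool of both bounds. Deleting `v` from `q` costs one element; uniqueness keeps the
-- other listed vertices in the remainder, and `v ∉ p` keeps `p` inside it.
length+∣p∣≤∣q∣ : {p q : Subset n} (vs : List (Fin n)) → Unique vs →
                 All (λ v → v ∈ q × v ∉ p) vs → p ⊆ q → length vs + ∣ p ∣ ≤ ∣ q ∣
length+∣p∣≤∣q∣ []       _            _                   p⊆q = p⊆q⇒∣p∣≤∣q∣ p⊆q
length+∣p∣≤∣q∣ (v ∷ vs) (v≢vs ∷ vs!) ((v∈q , v∉p) ∷ vs∈) p⊆q =
  ℕ.≤-trans (s≤s (length+∣p∣≤∣q∣ vs vs!
      (All.zipWith (λ { (v≢w , w∈q , w∉p) → x∈p∧x≢y⇒x∈p-y w∈q (v≢w ∘ sym) , w∉p }) (v≢vs , vs∈))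
      (λ w∈p → x∈p∧x≢y⇒x∈p-y (p⊆q w∈p) (λ { refl → v∉p w∈p }))))
    (x∈p⇒∣p-x∣<∣p∣ v∈q)

∣⁅x⁆∪p∣≤1+∣p∣ : (x : Fin n) (p : Subset n) → ∣ ⁅ x ⁆ ∪ p ∣ ≤ suc ∣ p ∣
∣⁅x⁆∪p∣≤1+∣p∣ zero    (inside  ∷ p) rewrite ∪-identityˡ p = s≤s (ℕ.n≤1+n _)
∣⁅x⁆∪p∣≤1+∣p∣ zero    (outside ∷ p) rewrite ∪-identityˡ p = ℕ.≤-refl
∣⁅x⁆∪p∣≤1+∣p∣ (suc x) (inside  ∷ p) = s≤s (∣⁅x⁆∪p∣≤1+∣p∣ x p)
∣⁅x⁆∪p∣≤1+∣p∣ (suc x) (outside ∷ p) = ∣⁅x⁆∪p∣≤1+∣p∣ x p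

fromList : List (Fin n) → Subset n
fromList []       = ⊥
fromList (v ∷ vs) = ⁅ v ⁆ ∪ fromList vs

∣fromList∣≤length : (vs : List (Fin n)) → ∣ fromList vs ∣ ≤ length vs
∣fromList∣≤length {n} []   = ℕ.≤-reflexive (∣⊥∣≡0 n)
∣fromList∣≤length (v ∷ vs) =
  ℕ.≤-trans (∣⁅x⁆∪p∣≤1+∣p∣ v (fromList vs)) (s≤s (∣fromList∣≤length vs))

∈-fromList⁺ : {v : Fin n} {vs : List (Fin n)} → v ∈ˡ vs → v ∈ fromList vs
∈-fromList⁺ (here refl) = x∈p∪q⁺ (inj₁ (x∈⁅x⁆ _))
∈-fromList⁺ (there v∈)  = x∈p∪q⁺ (inj₂ (∈-fromList⁺ v∈))

-- Closed neighbourhoods, triangles and triangle components.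

module _ (G : Graph (Fin n)) where
  open Graph G

  private
    variable
      S T : Subset n
      a b c r s u v w x y p q : Fin n

  ~⇒≢ : u ~ v → u ≢ v
  ~⇒≢ u~v refl = irrefl refl u~v

  Near : Fin n → Fin n → Set
  Near v u = u ≡ v ⊎ v ~ u

  near? : ∀ v u → Dec (Near v u)
  near? = ∈N[v]? G

  near-sym : Near v u → Near u v
  near-sym (inj₁ eq)  = inj₁ (sym eq)
  near-sym (inj₂ v~u) = inj₂ (symm v~u)

  remains? : ∀ S v → Decidable (λ u → u ∈ S × ¬ Near v u)
  remains? S v u = (u ∈? S) ×-dec ¬? (near? v u)

  infixl 6 _∖N_

  _∖N_ : Subset n → Fin n → Subset n
  S ∖N v = comprehension (remains? S v)

  ∈-∖N⁺ : u ∈ S → ¬ Near v u → u ∈ S ∖N v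
  ∈-∖N⁺ {S = S} {v = v} u∈S far = ∈-comprehension (remains? S v) (u∈S , far)

  ∈-∖N⁻ : u ∈ S ∖N v → u ∈ S × ¬ Near v u
  ∈-∖N⁻ {S = S} {v = v} = ∈-comprehension⁻ (remains? S v)

  ∖N⊆ : S ∖N v ⊆ S
  ∖N⊆ = proj₁ ∘ ∈-∖N⁻

  record Triangle (S : Subset n) (a b c : Fin n) : Set where
    constructor triangle
    field
      a∈ : a ∈ S
      b∈ : b ∈ S
      c∈ : c ∈ S
      ab : a ~ b
      bc : b ~ c
      ca : c ~ a

  rotate : Triangle S a b c → Triangle S b c a
  rotate (triangle a∈ b∈ c∈ ab bc ca) = triangle b∈ c∈ a∈ bc ca ab

  triangle? : ∀ S a b c → Dec (Triangle S a b c)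
  triangle? S a b c = map′
    (λ (a∈ , b∈ , c∈ , ab , bc , ca) → triangle a∈ b∈ c∈ ab bc ca)
    (λ (triangle a∈ b∈ c∈ ab bc ca) → a∈ , b∈ , c∈ , ab , bc , ca)
    ((a ∈? S) ×-dec (b ∈? S) ×-dec (c ∈? S) ×-dec (a ~? b) ×-dec (b ~? c) ×-dec (c ~? a))

  Closed : Subset n → Fin n → Fin n → Fin n → Set
  Closed S a b c = ∀ w → w ∈ S → a ~ w → w ≡ b ⊎ w ≡ c

  -- The bad triangles of the upper bound: a triangle is connected, so closedness at its three
  -- corners makes it a whole component of G[S].
  record Component (S : Subset n) (a b c : Fin n) : Set where
    constructor component
    field
      tri : Triangle S a b c
      na  : Closed S a b c
      nb  : Closed S b c a
      nc  : Closed S c a b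
    open Triangle tri public

  open Component

  rotateᶜ : Component S a b c → Component S b c a
  rotateᶜ (component t na nb nc) = component (rotate t) nb nc na

  swapᶜ : Component S a b c → Component S a c b
  swapᶜ (component (triangle a∈ b∈ c∈ ab bc ca) na nb nc) =
    component (triangle a∈ c∈ b∈ (symm ca) (symm bc) (symm ab))
      (λ w w∈ e → swap (na w w∈ e)) (λ w w∈ e → swap (nc w w∈ e)) (λ w w∈ e → swap (nb w w∈ e))

  component? : ∀ S a b c → Dec (Component S a b c)
  component? S a b c = map′
    (λ (t , na , nb , nc) → component t na nb nc)
    (λ (component t na nb nc) → t , na , nb , nc)
    (triangle? S a b c ×-dec closed? a b c ×-dec closed? b c a ×-dec closed? c a b)
    where
    closed? : ∀ a b c → Dec (Closed S a b c)
    closed? a b c = all? λ w → (w ∈? S) →-dec (a ~? w) →-dec ((w ≟ b) ⊎-dec (w ≟ c))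

  Bad : Subset n → Fin n → Set
  Bad S a = ∃₂ λ b c → Component S a b c

  bad? : ∀ S → Decidable (Bad S)
  bad? S a = any? λ b → any? λ c → component? S a b c

  bads : Subset n → Subset n
  bads S = comprehension (bad? S)

  bad-step : Bad S a → w ∈ S → a ~ w → Bad S w
  bad-step (b , c , K) w∈ a~w with na K _ w∈ a~w
  ... | inj₁ refl = _ , _ , rotateᶜ K
  ... | inj₂ refl = _ , _ , rotateᶜ (rotateᶜ K)

  -- The hypothesis ranges over all components, so it also applies to the rotations of `K`, and a
  -- condition on first corners covers all three.
  transfer : (∀ {a b c} → Component S a b c → a ∈ T × (∀ w → w ∈ T → a ~ w → w ∈ S)) →
             Component S a b c → Component T a b c
  transfer f K = component
    (triangle (proj₁ (f K)) (proj₁ (f K′)) (proj₁ (f K″)) (ab K) (bc K) (ca K))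
    (λ w w∈ e → na K w (proj₂ (f K) w w∈ e) e)
    (λ w w∈ e → nb K w (proj₂ (f K′) w w∈ e) e)
    (λ w w∈ e → nc K w (proj₂ (f K″) w w∈ e) e)
    where
    K′ = rotateᶜ K
    K″ = rotateᶜ K′

  -- Isolating lists and the cost of deletions.

  Isolates : Subset n → List (Fin n) → Set
  Isolates S ds = ∀ {a b c} → Triangle S a b c →
    ¬ (All (λ u → All (λ d → ¬ Near d u) ds) (a ∷ b ∷ c ∷ []))

  -- The bound |S|/4 without division. A list can stand for the isolating set because repetitions
  -- only make the resulting set smaller.
  Isolable : Subset n → Set
  Isolable S = ∃ λ ds → 4 * length ds ≤ ∣ S ∣ × Isolates S ds

  -- Deleting from S a set of at least 4 |es| vertices, provided every triangle
  -- touching it meets N[es].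
  extend : (es vs : List (Fin n)) → Unique vs → 4 * length es ≤ length vs →
           All (λ v → v ∈ S × v ∉ T) vs → T ⊆ S →
           (∀ {a b c} → Triangle S a b c →
             All (λ d → ¬ Near d a) es → All (λ d → ¬ Near d b) es → All (λ d → ¬ Near d c) es →
             a ∈ T) →
           Isolable T → Isolable S
  extend {S = S} {T = T} es vs vs! es≤vs vs∈ T⊆S inT (ds , ds≤ , iso) = es ++ ds , size , iso′
    where
    size : 4 * length (es ++ ds) ≤ ∣ S ∣
    size = begin
      4 * length (es ++ ds)           ≡⟨ cong (4 *_) (length-++ es) ⟩
      4 * (length es + length ds)     ≡⟨ ℕ.*-distribˡ-+ 4 (length es) (length ds) ⟩
      4 * length es + 4 * length ds   ≤⟨ ℕ.+-mono-≤ es≤vs ds≤ ⟩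
      length vs + ∣ T ∣               ≤⟨ length+∣p∣≤∣q∣ vs vs! vs∈ T⊆S ⟩
      ∣ S ∣                           ∎
      where open ℕ.≤-Reasoning

    iso′ : Isolates S (es ++ ds)
    iso′ t@(triangle a∈ b∈ c∈ ab bc ca) (fa ∷ fb ∷ fc ∷ []) =
      iso (triangle (inT t ea eb ec) (inT (rotate t) eb ec ea) (inT (rotate (rotate t)) ec ea eb) ab bc ca)
          (AllP.++⁻ʳ es fa ∷ AllP.++⁻ʳ es fb ∷ AllP.++⁻ʳ es fc ∷ [])
      where
      ea = AllP.++⁻ˡ es fa
      eb = AllP.++⁻ˡ es fb
      ec = AllP.++⁻ˡ es fc

  -- Hubs and the configuration of two triangles.

  Hub : Subset n → Fin n → List (Fin n) → Set
  Hub S v us = v ∈ S × 3 ≤ length us × Unique us × All (λ u → u ∈ S × v ~ u) us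

  -- The vertex `v` and its three or more neighbours pay for the dominator `v`, and a triangle
  -- avoiding N[v] survives in `S ∖N v`.
  extend-hub : ∀ {us} → Hub S v us → Isolable (S ∖N v) → Isolable S
  extend-hub {v = v} {us} (v∈S , 3≤us , us! , us∈) =
    extend (v ∷ []) (v ∷ us) (All.map (~⇒≢ ∘ proj₂) us∈ ∷ us!) (s≤s 3≤us)
      ((v∈S , (λ v∈ → proj₂ (∈-∖N⁻ v∈) (inj₁ refl)))
        ∷ All.map (λ { (u∈S , v~u) → u∈S , (λ u∈ → proj₂ (∈-∖N⁻ u∈) (inj₂ v~u)) }) us∈)
      ∖N⊆
      (λ { t (far ∷ []) _ _ → ∈-∖N⁺ (Triangle.a∈ t) far })

  -- The last case of the argument: the triangles v r s and y p q both hang at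
  -- x, and every edge leaving them goes to x or to the other triangle.
  record TwoTriangles (S U : Subset n) (v r s y p q x : Fin n) : Set₁ where
    field
      all∈S : All (_∈ S) (v ∷ r ∷ s ∷ x ∷ y ∷ p ∷ q ∷ [])
      all∉U : All (_∉ U) (v ∷ r ∷ s ∷ x ∷ y ∷ p ∷ q ∷ [])
      U⊆S   : U ⊆ S
      -- An eliminator in place of a disjunction: a case distinction on a vertex of `S` becomes a
      -- list of eight branches, and the symmetric versions arise by permuting arguments.
      elim  : (P : Fin n → Set) → P v → P r → P s → P x → P y → P p → P q →
              (∀ {w} → w ∈ U → P w) → ∀ {w} → w ∈ S → P w
      sep   : All (λ t → ∀ {u} → u ∈ U → ¬ t ~ u) (v ∷ r ∷ s ∷ y ∷ p ∷ q ∷ [])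
      good  : ∀ u → ¬ Bad U u
      v~r : v ~ r
      v~s : v ~ s
      r~s : r ~ s
      y~p : y ~ p
      y~q : y ~ q
      p~q : p ~ q
      x~v : x ~ v
      x~y : x ~ y
      v≁y : ¬ v ~ y
      v≁p : ¬ v ~ p
      v≁q : ¬ v ~ q
      y≁r : ¬ y ~ r
      y≁s : ¬ y ~ s

  module _ {S U : Subset n} where
    -- Together with `swap-triangles` this moves any of `s`, `p`, `q` into the place of `r`, so that
    -- later arguments need to treat only `r`.
    swap-rs : TwoTriangles S U v r s y p q x → TwoTriangles S U v s r y p q x
    swap-rs H = record
      { all∈S = case all∈S of λ { (v ∷ r ∷ s ∷ r′) → v ∷ s ∷ r ∷ r′ }
      ; all∉U = case all∉U of λ { (v ∷ r ∷ s ∷ r′) → v ∷ s ∷ r ∷ r′ }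
      ; U⊆S = U⊆S
      ; elim = λ P v r s → elim P v s r
      ; sep = case sep of λ { (v ∷ r ∷ s ∷ r′) → v ∷ s ∷ r ∷ r′ }
      ; good = good
      ; v~r = v~s ; v~s = v~r ; r~s = symm r~s
      ; y~p = y~p ; y~q = y~q ; p~q = p~q ; x~v = x~v ; x~y = x~y
      ; v≁y = v≁y ; v≁p = v≁p ; v≁q = v≁q ; y≁r = y≁s ; y≁s = y≁r
      }
      where open TwoTriangles H

    swap-triangles : TwoTriangles S U v r s y p q x → TwoTriangles S U y p q v r s x
    swap-triangles H = record
      { all∈S = case all∈S of λ { (v ∷ r ∷ s ∷ x ∷ y ∷ p ∷ q ∷ []) → y ∷ p ∷ q ∷ x ∷ v ∷ r ∷ s ∷ [] }
      ; all∉U = case all∉U of λ { (v ∷ r ∷ s ∷ x ∷ y ∷ p ∷ q ∷ []) → y ∷ p ∷ q ∷ x ∷ v ∷ r ∷ s ∷ [] }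
      ; U⊆S = U⊆S
      ; elim = λ P y p q x v r s → elim P v r s x y p q
      ; sep = case sep of λ { (v ∷ r ∷ s ∷ y ∷ p ∷ q ∷ []) → y ∷ p ∷ q ∷ v ∷ r ∷ s ∷ [] }
      ; good = good
      ; v~r = y~p ; v~s = y~q ; r~s = p~q
      ; y~p = v~r ; y~q = v~s ; p~q = r~s ; x~v = x~y ; x~y = x~v
      ; v≁y = v≁y ∘ symm ; v≁p = y≁r ; v≁q = y≁s ; y≁r = v≁p ; y≁s = v≁q
      }
      where open TwoTriangles H

    open TwoTriangles

    nbr-y : TwoTriangles S U v r s y p q x → w ∈ S → y ~ w → w ≡ p ⊎ w ≡ q ⊎ w ≡ x
    nbr-y {y = y} {p = p} {q = q} {x = x} H w∈S = elim H (λ w → y ~ w → w ≡ p ⊎ w ≡ q ⊎ w ≡ x)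
      (⊥-elim ∘ v≁y H ∘ symm) (⊥-elim ∘ y≁r H) (⊥-elim ∘ y≁s H)
      (λ _ → inj₂ (inj₂ refl)) (⊥-elim ∘ irrefl refl)
      (λ _ → inj₁ refl) (λ _ → inj₂ (inj₁ refl))
      (λ w∈U e → ⊥-elim (All.lookup (sep H) (there (there (there (here refl)))) w∈U e)) w∈S

    nbr-r : TwoTriangles S U v r s y p q x → w ∈ S → r ~ w → ¬ Near x w → w ≡ s ⊎ w ≡ p ⊎ w ≡ q
    nbr-r {r = r} {s = s} {p = p} {q = q} {x = x} H w∈S =
      elim H (λ w → r ~ w → ¬ Near x w → w ≡ s ⊎ w ≡ p ⊎ w ≡ q)
      (λ _ far → ⊥-elim (far (inj₂ (x~v H)))) (⊥-elim ∘ irrefl refl) (λ _ _ → inj₁ refl)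
      (λ _ far → ⊥-elim (far (inj₁ refl))) (λ e → ⊥-elim (y≁r H (symm e)))
      (λ _ _ → inj₂ (inj₁ refl)) (λ _ _ → inj₂ (inj₂ refl))
      (λ w∈U e → ⊥-elim (All.lookup (sep H) (there (here refl)) w∈U e)) w∈S

    -- No such triangle exists: the other two corners would be two of `s`, `p`, `q`, and each of the
    -- three pairs is excluded by one of the negated hypotheses. The vacuous conclusion `r ∈ U` has
    -- the shape that `elim` asks for in `two-triangles`.
    r∉triangle : TwoTriangles S U v r s y p q x →
      ¬ (r ~ p × r ~ q) → ¬ (p ~ r × p ~ s) → ¬ (q ~ r × q ~ s) →
      Triangle S r b c → ¬ Near x b → ¬ Near x c → r ∈ U
    r∉triangle H ¬r ¬p ¬q (triangle _ b∈ c∈ rb bc cr) fb fc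
      with nbr-r H b∈ rb fb | nbr-r H c∈ (symm cr) fc
    ... | inj₁ refl        | inj₁ refl        = ⊥-elim (irrefl refl bc)
    ... | inj₁ refl        | inj₂ (inj₁ refl) = ⊥-elim (¬p (cr , symm bc))
    ... | inj₁ refl        | inj₂ (inj₂ refl) = ⊥-elim (¬q (cr , symm bc))
    ... | inj₂ (inj₁ refl) | inj₁ refl        = ⊥-elim (¬p (symm rb , bc))
    ... | inj₂ (inj₁ refl) | inj₂ (inj₁ refl) = ⊥-elim (irrefl refl bc)
    ... | inj₂ (inj₁ refl) | inj₂ (inj₂ refl) = ⊥-elim (¬r (rb , symm cr))
    ... | inj₂ (inj₂ refl) | inj₁ refl        = ⊥-elim (¬q (symm rb , bc))
    ... | inj₂ (inj₂ refl) | inj₂ (inj₁ refl) = ⊥-elim (¬r (symm cr , rb))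
    ... | inj₂ (inj₂ refl) | inj₂ (inj₂ refl) = ⊥-elim (irrefl refl bc)

  -- The induction step for a set without bad triangles.

  module Step (S : Subset n) (good : ∀ u → ¬ Bad S u)
              (IH : ∀ T → ∣ T ∣ < ∣ S ∣ → (∀ u → ¬ Bad T u) → Isolable T) where

    IH′ : T ⊆ S → v ∈ S → v ∉ T → (∀ u → ¬ Bad T u) → Isolable T
    IH′ {T = T} T⊆S v∈S v∉T = IH T (p⊂q⇒∣p∣<∣q∣ (T⊆S , _ , v∈S , v∉T))

    isolable-if-good : ∀ {us} → Hub S v us → (∀ u → ¬ Bad (S ∖N v) u) → Isolable S
    isolable-if-good {v = v} hub good′ =
      extend-hub hub (IH′ ∖N⊆ (proj₁ hub) (λ v∈ → proj₂ (∈-∖N⁻ {v = v} v∈) (inj₁ refl)) good′)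

    Linked : Fin n → Fin n → Set
    Linked v y = ∃ λ x → x ∈ S × v ~ x × y ~ x

    linked? : ∀ v y → Dec (Linked v y)
    linked? v y = any? λ x → (x ∈? S) ×-dec (v ~? x) ×-dec (y ~? x)

    -- No corner is adjacent to `v`. If no corner had a neighbour in N(v) either, the triangle would
    -- already be a component of G[S], against `good`.
    attached : Component (S ∖N v) a b c → Linked v a ⊎ Linked v b ⊎ Linked v c
    attached {v = v} {a} {b} {c} K with linked? v a | linked? v b | linked? v c
    ... | yes l | _     | _     = inj₁ l
    ... | no _  | yes l | _     = inj₂ (inj₁ l)
    ... | no _  | no _  | yes l = inj₂ (inj₂ l)
    ... | no ¬a | no ¬b | no ¬c = ⊥-elim (good a (b , c , component
      (triangle (∖N⊆ (a∈ K)) (∖N⊆ (b∈ K)) (∖N⊆ (c∈ K)) (ab K) (bc K) (ca K))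
      (closed K ¬a) (closed (rotateᶜ K) ¬b) (closed (rotateᶜ (rotateᶜ K)) ¬c)))
      where
      closed : ∀ {a b c} → Component (S ∖N v) a b c → ¬ Linked v a → Closed S a b c
      closed K ¬l w w∈S a~w with near? v w
      ... | no far         = na K w (∈-∖N⁺ w∈S far) a~w
      ... | yes (inj₁ refl) = ⊥-elim (proj₂ (∈-∖N⁻ (a∈ K)) (inj₂ (symm a~w)))
      ... | yes (inj₂ v~w) = ⊥-elim (¬l (w , w∈S , v~w , a~w))

    module _ {U v r s y p q x} (H : TwoTriangles S U v r s y p q x) where
      open TwoTriangles H using (all∈S; all∉U; U⊆S; elim; sep; v~r; v~s; r~s; y~p; y~q; p~q; x~v; x~y; v≁y; v≁p; v≁q; y≁r; y≁s)
      open TwoTriangles H using () renaming (good to goodU)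

      -- Deleting N[r] removes `v`, `r`, `s`, `p`, `q`. The surviving `y` has no neighbour left
      -- except possibly `x`, so `y` is in no triangle and `x`, adjacent to `y`, is not bad. A bad
      -- triangle would thus lie inside `U` and be bad there.
      r-dominates : r ~ p → r ~ q → Isolable S
      r-dominates r~p r~q = isolable-if-good {us = v ∷ s ∷ p ∷ []}
        (r∈S , ℕ.≤-refl ,
          ((~⇒≢ v~s ∷ (λ { refl → v≁y (symm y~p) }) ∷ []) ∷ ((λ { refl → v≁p v~s }) ∷ []) ∷ [] ∷ []) ,
          ((v∈S , symm v~r) ∷ (s∈S , r~s) ∷ (p∈S , r~p) ∷ []))
        (λ u (b , c , K) → goodU u (b , c , transfer (λ K → inU (a∈ K) K , λ w w∈U _ →
          ∈-∖N⁺ (U⊆S w∈U) λ { (inj₁ refl) → r∉U w∈U ; (inj₂ e) → r-sep w∈U e }) K))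
        where
        v∈S = All.lookup all∈S (here refl)
        r∈S = All.lookup all∈S (there (here refl))
        s∈S = All.lookup all∈S (there (there (here refl)))
        y∈S = All.lookup all∈S (there (there (there (there (here refl)))))
        p∈S = All.lookup all∈S (there (there (there (there (there (here refl))))))
        r∉U = All.lookup all∉U (there (here refl))
        r-sep = All.lookup sep (there (here refl))

        near⊥ : ∀ {A : Set} {w b c} → Near r w → Component (S ∖N r) w b c → A
        near⊥ nr K = ⊥-elim (proj₂ (∈-∖N⁻ (a∈ K)) nr)

        nbr-y-far : w ∈ S ∖N r → y ~ w → w ≡ x
        nbr-y-far w∈ y~w with nbr-y H (∖N⊆ w∈) y~w
        ... | inj₁ refl        = ⊥-elim (proj₂ (∈-∖N⁻ w∈) (inj₂ r~p))
        ... | inj₂ (inj₁ refl) = ⊥-elim (proj₂ (∈-∖N⁻ w∈) (inj₂ r~q))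
        ... | inj₂ (inj₂ w≡x)  = w≡x

        y-good : ¬ Bad (S ∖N r) y
        y-good (b , c , K) = irrefl
          (trans (nbr-y-far (b∈ K) (ab K)) (sym (nbr-y-far (c∈ K) (symm (ca K))))) (bc K)

        y∈ : y ∈ S ∖N r
        y∈ = ∈-∖N⁺ y∈S λ { (inj₁ refl) → v≁y v~r ; (inj₂ e) → y≁r (symm e) }

        inU : ∀ {w} → w ∈ S ∖N r → ∀ {b c} → Component (S ∖N r) w b c → w ∈ U
        inU w∈ = elim (λ w → ∀ {b c} → Component (S ∖N r) w b c → w ∈ U)
          (near⊥ (inj₂ (symm v~r))) (near⊥ (inj₁ refl)) (near⊥ (inj₂ r~s))
          (λ K → ⊥-elim (y-good (bad-step (_ , _ , K) y∈ x~y)))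
          (λ K → ⊥-elim (y-good (_ , _ , K)))
          (near⊥ (inj₂ r~p)) (near⊥ (inj₂ r~q))
          (λ w∈U _ → w∈U) (∖N⊆ w∈)

    -- A vertex of {r, s} adjacent to both `p` and `q`, or of {p, q} adjacent to both `r` and `s`,
    -- is a hub whose removal leaves no bad triangle. If there is none, every triangle avoiding N[x]
    -- lies in `U`, so `x` is added to an isolating list of `U`.
    two-triangles : ∀ {U v r s y p q x} → TwoTriangles S U v r s y p q x → Isolable S
    two-triangles {U} {v} {r} {s} {y} {p} {q} {x} H
      with (r ~? p) ×-dec (r ~? q) | (s ~? p) ×-dec (s ~? q)
         | (p ~? r) ×-dec (p ~? s) | (q ~? r) ×-dec (q ~? s)
    ... | yes (r~p , r~q) | _ | _ | _ = r-dominates H r~p r~q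
    ... | _ | yes (s~p , s~q) | _ | _ = r-dominates (swap-rs H) s~p s~q
    ... | _ | _ | yes (p~r , p~s) | _ = r-dominates (swap-triangles H) p~r p~s
    ... | _ | _ | _ | yes (q~r , q~s) = r-dominates (swap-rs (swap-triangles H)) q~r q~s
    ... | no ¬r | no ¬s | no ¬p | no ¬q with TwoTriangles.all∈S H | TwoTriangles.all∉U H
    ...   | v∈S ∷ r∈S ∷ s∈S ∷ x∈S ∷ y∈S ∷ _ | v∉U ∷ r∉U ∷ s∉U ∷ x∉U ∷ y∉U ∷ _ =
      -- Four of the seven deleted vertices suffice to pay for the single dominator `x`.
      extend (x ∷ []) (x ∷ v ∷ y ∷ r ∷ [])
        ((~⇒≢ x~v ∷ ~⇒≢ x~y ∷ (λ { refl → y≁r (symm x~y) }) ∷ []) ∷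
         ((λ { refl → y≁r v~r }) ∷ ~⇒≢ v~r ∷ []) ∷ ((λ { refl → v≁y v~r }) ∷ []) ∷ [] ∷ [])
        ℕ.≤-refl
        ((x∈S , x∉U) ∷ (v∈S , v∉U) ∷ (y∈S , y∉U) ∷ (r∈S , r∉U) ∷ [])
        U⊆S
        (λ { t (fa ∷ []) (fb ∷ []) (fc ∷ []) → inU (Triangle.a∈ t) t fa fb fc })
        (IH′ U⊆S x∈S x∉U goodU)
      where
      open TwoTriangles H using (U⊆S; elim; v~r; x~v; x~y; v≁y; y≁r) renaming (good to goodU)

      ×-swap : ∀ {A B : Set} → ¬ (A × B) → ¬ (B × A)
      ×-swap f (b , a) = f (a , b)

      inU : ∀ {a} → a ∈ S → ∀ {b c} → Triangle S a b c →
            ¬ Near x a → ¬ Near x b → ¬ Near x c → a ∈ U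
      inU = elim (λ a → ∀ {b c} → Triangle S a b c → ¬ Near x a → ¬ Near x b → ¬ Near x c → a ∈ U)
        (λ _ fa → ⊥-elim (fa (inj₂ x~v)))
        (λ t _ → r∉triangle H ¬r ¬p ¬q t)
        (λ t _ → r∉triangle (swap-rs H) ¬s (×-swap ¬p) (×-swap ¬q) t)
        (λ _ fa → ⊥-elim (fa (inj₁ refl)))
        (λ _ fa → ⊥-elim (fa (inj₂ x~y)))
        (λ t _ → r∉triangle (swap-triangles H) ¬p ¬r ¬s t)
        (λ t _ → r∉triangle (swap-rs (swap-triangles H)) ¬q (×-swap ¬r) (×-swap ¬s) t)
        (λ w∈U _ _ _ _ → w∈U)

    -- The case where no replacement of the hub is available.

    module Stuck {v} {us} (hub : Hub S v us)
                 (stuck : ∀ y → Bad (S ∖N v) y → Linked v y → Bad (S ∖N y) v)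
                 {y p q x} (K : Component (S ∖N v) y p q) (x∈S : x ∈ S) (v~x : v ~ x) (y~x : y ~ x) where

      v∈S : v ∈ S
      v∈S = proj₁ hub

      far : w ∈ S ∖N v → ¬ Near v w
      far = proj₂ ∘ ∈-∖N⁻

      v≁y : ¬ v ~ y
      v≁y = far (a∈ K) ∘ inj₂

      -- If `a` is adjacent to `x`, or if `y` is a corner of this triangle, then `x` touches it.
      -- Otherwise `x` and `y` both survive in `S ∖N a`, where `stuck` puts `v` in a bad triangle;
      -- it absorbs the neighbour `x` of `v` and then the neighbour `y` of `x`, contradicting that
      -- `y` is not in N[v].
      touches-linked : Component (S ∖N v) a b c → Linked v a → x ~ a ⊎ x ~ b ⊎ x ~ c
      touches-linked {a} K′ l with near? a x | near? a y
      ... | yes (inj₁ refl) | _               = ⊥-elim (far (a∈ K′) (inj₂ v~x))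
      ... | yes (inj₂ a~x)  | _               = inj₁ (symm a~x)
      ... | no _            | yes (inj₁ refl) = inj₁ (symm y~x)
      ... | no _            | yes (inj₂ a~y) with na K′ _ (a∈ K) a~y
      ...   | inj₁ refl = inj₂ (inj₁ (symm y~x))
      ...   | inj₂ refl = inj₂ (inj₂ (symm y~x))
      touches-linked {a} K′ l | no x≁a | no y≁a with stuck a (_ , _ , K′) l
      ... | r , s , C with na C x (∈-∖N⁺ x∈S x≁a) v~x
      ...   | inj₁ refl with nb C y (∈-∖N⁺ (∖N⊆ (a∈ K)) y≁a) (symm y~x)
      ...     | inj₁ refl = ⊥-elim (v≁y (symm (ca C)))
      ...     | inj₂ refl = ⊥-elim (far (a∈ K) (inj₁ refl))
      touches-linked {a} K′ l | no x≁a | no y≁a | r , s , C | inj₂ refl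
        with nc C y (∈-∖N⁺ (∖N⊆ (a∈ K)) y≁a) (symm y~x)
      ...     | inj₁ refl = ⊥-elim (far (a∈ K) (inj₁ refl))
      ...     | inj₂ refl = ⊥-elim (v≁y (ab C))

      touches : Component (S ∖N v) a b c → x ~ a ⊎ x ~ b ⊎ x ~ c
      touches K′ with attached K′
      ... | inj₁ l        = touches-linked K′ l
      ... | inj₂ (inj₁ l) = [ inj₂ ∘ inj₁ , [ inj₂ ∘ inj₂ , inj₁ ]′ ]′ (touches-linked (rotateᶜ K′) l)
      ... | inj₂ (inj₂ l) = [ inj₂ ∘ inj₂ , [ inj₁ , inj₂ ∘ inj₁ ]′ ]′ (touches-linked (rotateᶜ (rotateᶜ K′)) l)

      -- A triangle of `S ∖N v` with a bad corner is itself the bad component, which `x` touches by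
      -- `touches`.
      bad-avoids : Triangle S a b c → Bad (S ∖N v) a →
                   b ∈ S ∖N v → c ∈ S ∖N v → ¬ x ~ a → ¬ x ~ b → ¬ x ~ c → Empty.⊥
      bad-avoids (triangle _ _ _ ab′ bc′ ca′) (_ , _ , K′) b∈′ c∈′ ¬a ¬b ¬c
        with na K′ _ b∈′ ab′ | na K′ _ c∈′ (symm ca′)
      ... | inj₁ refl | inj₁ refl = irrefl refl bc′
      ... | inj₂ refl | inj₂ refl = irrefl refl bc′
      ... | inj₁ refl | inj₂ refl = [ ¬a , [ ¬b , ¬c ]′ ]′ (touches K′)
      ... | inj₂ refl | inj₁ refl = [ ¬a , [ ¬c , ¬b ]′ ]′ (touches K′)

      rest? : Decidable (λ u → u ∈ S ∖N v × ¬ Bad (S ∖N v) u)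
      rest? u = (u ∈? S ∖N v) ×-dec ¬? (bad? (S ∖N v) u)

      rest : Subset n
      rest = comprehension rest?

      rest⁻ : u ∈ rest → u ∈ S ∖N v × ¬ Bad (S ∖N v) u
      rest⁻ = ∈-comprehension⁻ rest?

      -- Bad vertices fill whole components of `S ∖N v`, so deleting them takes no neighbour from a
      -- remaining vertex and creates no new bad triangle.
      rest-good : ∀ u → ¬ Bad rest u
      rest-good u (b , c , C) = proj₂ (rest⁻ (a∈ C)) (b , c , transfer
        (λ C → proj₁ (rest⁻ (a∈ C)) , λ w w∈ a~w → ∈-comprehension rest?
          (w∈ , λ bad → proj₂ (rest⁻ (a∈ C)) (bad-step bad (proj₁ (rest⁻ (a∈ C))) (symm a~w)))) C)

      -- The two dominators `v` and `x` handle N[v] and all bad triangles at once; eight deleted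
      -- vertices pay for them.
      isolable-if-many : (vs : List (Fin n)) → Unique vs → 8 ≤ length vs →
             All (λ z → z ∈ S × (Near v z ⊎ Bad (S ∖N v) z)) vs → Isolable S
      isolable-if-many vs vs! 8≤ vs∈ = extend (v ∷ x ∷ []) vs vs! 8≤
        (All.map (λ { (z∈S , z) → z∈S , λ z∈ → [ far (proj₁ (rest⁻ z∈)) , proj₂ (rest⁻ z∈) ]′ z }) vs∈)
        (∖N⊆ ∘ proj₁ ∘ rest⁻)
        (λ { t (va ∷ xa ∷ []) (vb ∷ xb ∷ []) (vc ∷ xc ∷ []) →
          let a∈ = ∈-∖N⁺ (Triangle.a∈ t) va
              b∈ = ∈-∖N⁺ (Triangle.b∈ t) vb
              c∈ = ∈-∖N⁺ (Triangle.c∈ t) vc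
          in ∈-comprehension rest?
               (a∈ , λ bad → bad-avoids t bad b∈ c∈ (xa ∘ inj₂) (xb ∘ inj₂) (xc ∘ inj₂)) })
        (IH′ (∖N⊆ ∘ proj₁ ∘ rest⁻) v∈S (λ v∈ → far (proj₁ (rest⁻ v∈)) (inj₁ refl)) rest-good)

      module _ {r s} (C : Component (S ∖N y) v r s) where

        L : List (Fin n)
        L = v ∷ r ∷ s ∷ x ∷ y ∷ p ∷ q ∷ []

        y≁ : w ∈ S ∖N y → ¬ y ~ w
        y≁ w∈ = proj₂ (∈-∖N⁻ w∈) ∘ inj₂

        bad-p : Component (S ∖N v) p q y
        bad-p = rotateᶜ K

        bad-q : Component (S ∖N v) q y p
        bad-q = rotateᶜ bad-p

        L! : Unique L
        L! = Unique.++⁺ {xs = v ∷ r ∷ s ∷ x ∷ []}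
          ((~⇒≢ (ab C) ∷ ~⇒≢ (symm (ca C)) ∷ ~⇒≢ v~x ∷ []) ∷
           (~⇒≢ (bc C) ∷ (λ { refl → y≁ (b∈ C) y~x }) ∷ []) ∷
           ((λ { refl → y≁ (c∈ C) y~x }) ∷ []) ∷ [] ∷ [])
          ((~⇒≢ (ab K) ∷ ~⇒≢ (symm (ca K)) ∷ []) ∷ (~⇒≢ (bc K) ∷ []) ∷ [] ∷ [])
          -- The first four vertices lie in N[v], the last three outside it.
          (λ { (i , j) → All.lookup {P = ¬_ ∘ Near v}
                 (far (a∈ K) ∷ far (b∈ K) ∷ far (c∈ K) ∷ []) j
                 (All.lookup {P = Near v} (inj₁ refl ∷ inj₂ (ab C) ∷ inj₂ (symm (ca C)) ∷ inj₂ v~x ∷ []) i) })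

        L∈ : All (λ z → z ∈ S × (Near v z ⊎ Bad (S ∖N v) z)) L
        L∈ = (v∈S , inj₁ (inj₁ refl)) ∷ (∖N⊆ (b∈ C) , inj₁ (inj₂ (ab C))) ∷
             (∖N⊆ (c∈ C) , inj₁ (inj₂ (symm (ca C)))) ∷ (x∈S , inj₁ (inj₂ v~x)) ∷
             (∖N⊆ (a∈ K) , inj₂ (_ , _ , K)) ∷ (∖N⊆ (b∈ K) , inj₂ (_ , _ , bad-p)) ∷
             (∖N⊆ (c∈ K) , inj₂ (_ , _ , bad-q)) ∷ []

        module _ (only-L : ∀ {z} → z ∈ S → Near v z ⊎ Bad (S ∖N v) z → z ∈ˡ L) where

          outside? : Decidable (λ u → u ∈ S × u ∉ˡ L)
          outside? u = (u ∈? S) ×-dec ¬? (u ∈ˡ? L)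

          U : Subset n
          U = comprehension outside?

          U⁻ : u ∈ U → u ∈ S × u ∉ˡ L
          U⁻ = ∈-comprehension⁻ outside?

          ∉U : u ∈ˡ L → u ∉ U
          ∉U u∈L u∈U = proj₂ (U⁻ u∈U) u∈L

          U-far : u ∈ U → ¬ Near v u
          U-far u∈U nr = ∉U (only-L (proj₁ (U⁻ u∈U)) (inj₁ nr)) u∈U

          U⊆S∖Nv : U ⊆ S ∖N v
          U⊆S∖Nv u∈U = ∈-∖N⁺ (proj₁ (U⁻ u∈U)) (U-far u∈U)

          elim′ : (P : Fin n → Set) → P v → P r → P s → P x → P y → P p → P q →
                  (∀ {w} → w ∈ U → P w) → ∀ {w} → w ∈ S → P w
          elim′ P Pv Pr Ps Px Py Pp Pq PU {w} w∈S with w ∈ˡ? L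
          ... | yes w∈L = All.lookup {P = P} (Pv ∷ Pr ∷ Ps ∷ Px ∷ Py ∷ Pp ∷ Pq ∷ []) w∈L
          ... | no  w∉L = PU (∈-comprehension outside? (w∈S , w∉L))

          sep-bad : Bad (S ∖N v) w → u ∈ U → ¬ w ~ u
          sep-bad bad u∈U w~u =
            ∉U (only-L (proj₁ (U⁻ u∈U)) (inj₂ (bad-step bad (U⊆S∖Nv u∈U) w~u))) u∈U

          U-far-y : u ∈ U → ¬ Near y u
          U-far-y u∈U (inj₁ refl) = ∉U (there (there (there (there (here refl))))) u∈U
          U-far-y u∈U (inj₂ y~u)  = sep-bad (_ , _ , K) u∈U y~u

          U⊆S∖Ny : U ⊆ S ∖N y
          U⊆S∖Ny u∈U = ∈-∖N⁺ (proj₁ (U⁻ u∈U)) (U-far-y u∈U)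

          sep-r : u ∈ U → ¬ r ~ u
          sep-r u∈U r~u with nb C _ (U⊆S∖Ny u∈U) r~u
          ... | inj₁ refl = ∉U (there (there (here refl))) u∈U
          ... | inj₂ refl = ∉U (here refl) u∈U

          sep-s : u ∈ U → ¬ s ~ u
          sep-s u∈U s~u with nc C _ (U⊆S∖Ny u∈U) s~u
          ... | inj₁ refl = ∉U (here refl) u∈U
          ... | inj₂ refl = ∉U (there (here refl)) u∈U

          -- Outside `U`, only `y`, `p`, `q` survive in `S ∖N v`, and they send no edge into `U`. A
          -- bad triangle of `U` would therefore be bad in `S ∖N v`, and `only-L` would place it in
          -- `L`.
          U-good : ∀ u → ¬ Bad U u
          U-good u (b , c , D) = ∉U (only-L (proj₁ (U⁻ (a∈ D))) (inj₂ (b , c , transfer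
            (λ D → U⊆S∖Nv (a∈ D) , λ w w∈ → elim′ (λ w → w ∈ S ∖N v → _ ~ w → w ∈ U)
              (λ w∈ → ⊥-elim (far w∈ (inj₁ refl)))
              (λ w∈ → ⊥-elim (far w∈ (inj₂ (ab C))))
              (λ w∈ → ⊥-elim (far w∈ (inj₂ (symm (ca C)))))
              (λ w∈ → ⊥-elim (far w∈ (inj₂ v~x)))
              (λ _ e → ⊥-elim (sep-bad (_ , _ , K) (a∈ D) (symm e)))
              (λ _ e → ⊥-elim (sep-bad (_ , _ , bad-p) (a∈ D) (symm e)))
              (λ _ e → ⊥-elim (sep-bad (_ , _ , bad-q) (a∈ D) (symm e)))
              (λ w∈U _ _ → w∈U) (∖N⊆ w∈) w∈) D))) (a∈ D)

          two : TwoTriangles S U v r s y p q x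
          two = record
            { all∈S = All.map proj₁ L∈
            ; all∉U = All.tabulate ∉U
            ; U⊆S = proj₁ ∘ U⁻
            ; elim = elim′
            ; sep = (λ u∈U e → U-far u∈U (inj₂ e)) ∷ sep-r ∷ sep-s ∷ sep-bad (_ , _ , K)
                    ∷ sep-bad (_ , _ , bad-p) ∷ sep-bad (_ , _ , bad-q) ∷ []
            ; good = U-good
            ; v~r = ab C ; v~s = symm (ca C) ; r~s = bc C
            ; y~p = ab K ; y~q = symm (ca K) ; p~q = bc K
            ; x~v = symm v~x ; x~y = symm y~x
            ; v≁y = v≁y
            ; v≁p = far (b∈ K) ∘ inj₂ ; v≁q = far (c∈ K) ∘ inj₂
            ; y≁r = y≁ (b∈ C) ; y≁s = y≁ (c∈ C)
            }

        -- Either N[v] and the bad triangles contain an eighth vertex besides the seven of `L`,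
        -- which pays for two dominators, or `L` is all of them and the two-triangle configuration
        -- arises.
        conclude : Isolable S
        conclude with any? (λ z → (z ∈? S) ×-dec (near? v z ⊎-dec bad? (S ∖N v) z) ×-dec ¬? (z ∈ˡ? L))
        ... | yes (z , z∈S , z∈ , z∉L) = isolable-if-many (z ∷ L) (AllP.¬Any⇒All¬ L z∉L ∷ L!) ℕ.≤-refl ((z∈S , z∈) ∷ L∈)
        ... | no none = two-triangles (two only-L)
          where
          only-L : ∀ {z} → z ∈ S → Near v z ⊎ Bad (S ∖N v) z → z ∈ˡ L
          only-L {z} z∈S z∈ with z ∈ˡ? L
          ... | yes z∈L = z∈L
          ... | no  z∉L = ⊥-elim (none (z , z∈S , z∈ , z∉L))

    -- Replacing the hub, and the end of the induction step.

    -- Since `v` survives in `S ∖N y` without being bad, no bad triangle there meets N[v], so each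
    -- is also bad in `S ∖N v`. The inclusion is strict because `y` is bad only in `S ∖N v`.
    bads-decrease : v ∈ S → ¬ Bad (S ∖N y) v → Component (S ∖N v) y p q →
                    ∣ bads (S ∖N y) ∣ < ∣ bads (S ∖N v) ∣
    bads-decrease {v} {y} v∈S v-good K = p⊂q⇒∣p∣<∣q∣
      ( (λ u∈ → case ∈-comprehension⁻ (bad? (S ∖N y)) u∈ of λ (b , c , C) →
          ∈-comprehension (bad? (S ∖N v)) (b , c , transfer (λ C → far-v C , stays C) C))
      , y
      , ∈-comprehension (bad? (S ∖N v)) (_ , _ , K)
      , λ y∈ → case ∈-comprehension⁻ (bad? (S ∖N y)) y∈ of λ (b , c , C) →
          proj₂ (∈-∖N⁻ (a∈ C)) (inj₁ refl))
      where
      v∈ : v ∈ S ∖N y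
      v∈ = ∈-∖N⁺ v∈S (proj₂ (∈-∖N⁻ (a∈ K)) ∘ near-sym)

      far-v : Component (S ∖N y) a b c → a ∈ S ∖N v
      far-v C = ∈-∖N⁺ (∖N⊆ (a∈ C)) λ
        { (inj₁ refl) → v-good (_ , _ , C)
        ; (inj₂ v~a)  → v-good (bad-step (_ , _ , C) v∈ (symm v~a)) }

      -- If `w` were in N[y], it would be a corner of the component `K`; its neighbour `a` would
      -- then be a corner too, hence in N[y].
      stays : Component (S ∖N y) a b c → ∀ w → w ∈ S ∖N v → a ~ w → w ∈ S ∖N y
      stays {a} C w w∈ a~w = ∈-∖N⁺ (∖N⊆ w∈) (proj₂ (∈-∖N⁻ (a∈ C)) ∘ near)
        where
        near : Near y w → Near y a
        near (inj₁ refl) = inj₂ (symm a~w)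
        near (inj₂ y~w) with na K w w∈ y~w
        ... | inj₁ refl = [ (λ { refl → inj₂ (symm (ca K)) }) , inj₁ ]′ (nb K a (far-v C) (symm a~w))
        ... | inj₂ refl = [ inj₁ , (λ { refl → inj₂ (ab K) }) ]′ (nc K a (far-v C) (symm a~w))

    -- The recursion ends because each replacement lowers the number of bad vertices left by the
    -- hub.
    isolable-from-hub : ∀ v {us} → Hub S v us → Acc _<_ ∣ bads (S ∖N v) ∣ → Isolable S
    isolable-from-hub v hub (acc rec) with any? (bad? (S ∖N v))
    ... | no none = isolable-if-good hub (λ u bad → none (u , bad))
    ... | yes (y , p , q , K)
      with any? (λ y → bad? (S ∖N v) y ×-dec linked? v y ×-dec ¬? (bad? (S ∖N y) v))
    -- The new hub `y` has the neighbours `p`, `q`, `x`; `x` differs from the others because it lies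
    -- in N(v) and they do not.
    ...   | yes (y , (p , q , K) , (x , x∈S , v~x , y~x) , v-good) =
      isolable-from-hub y {p ∷ q ∷ x ∷ []}
        ( ∖N⊆ (a∈ K) , ℕ.≤-refl
        , (~⇒≢ (bc K) ∷ (λ { refl → far (b∈ K) (inj₂ v~x) }) ∷ []) ∷
            ((λ { refl → far (c∈ K) (inj₂ v~x) }) ∷ []) ∷ [] ∷ []
        , (∖N⊆ (b∈ K) , ab K) ∷ (∖N⊆ (c∈ K) , symm (ca K)) ∷ (x∈S , y~x) ∷ [])
        (rec (bads-decrease (proj₁ hub) v-good K))
      where
      far : w ∈ S ∖N v → ¬ Near v w
      far = proj₂ ∘ ∈-∖N⁻
    -- The component is rotated until its first corner shares a neighbour with `v`.
    ...   | no none = [ go K , [ go (rotateᶜ K) , go (rotateᶜ (rotateᶜ K)) ]′ ]′ (attached K)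
      where
      stuck : ∀ y → Bad (S ∖N v) y → Linked v y → Bad (S ∖N y) v
      stuck y bad l with bad? (S ∖N y) v
      ... | yes b = b
      ... | no ¬b = ⊥-elim (none (y , bad , l , ¬b))

      go : Component (S ∖N v) a b c → Linked v a → Isolable S
      go K l@(x , x∈S , v~x , a~x) =
        Stuck.conclude hub stuck K x∈S v~x a~x (proj₂ (proj₂ (stuck _ (_ , _ , K) l)))

    -- A triangle corner with a further neighbour is a hub. If no such corner exists, every triangle
    -- is a component, hence bad; so there is no triangle and the empty list isolates.
    isolable-step : Isolable S
    isolable-step
      with any? (λ a → any? λ b → any? λ c → any? λ w →
             triangle? S a b c ×-dec (w ∈? S) ×-dec (a ~? w) ×-dec ¬? (b ≟ w) ×-dec ¬? (c ≟ w))
    ... | yes (a , b , c , w , triangle a∈ b∈ c∈ ab bc ca , w∈ , a~w , b≢w , c≢w) =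
      isolable-from-hub a {b ∷ c ∷ w ∷ []}
        ( a∈ , ℕ.≤-refl , (~⇒≢ bc ∷ b≢w ∷ []) ∷ (c≢w ∷ []) ∷ [] ∷ []
        , (b∈ , ab) ∷ (c∈ , symm ca) ∷ (w∈ , a~w) ∷ [])
        (<-wellFounded _)
    ... | no none = [] , z≤n , λ t _ → good _ (_ , _ ,
      component t (closed t) (closed (rotate t)) (closed (rotate (rotate t))))
      where
      closed : Triangle S a b c → Closed S a b c
      closed {a} {b} {c} t w w∈ a~w with b ≟ w | c ≟ w
      ... | yes b≡w | _       = inj₁ (sym b≡w)
      ... | no _    | yes c≡w = inj₂ (sym c≡w)
      ... | no b≢w  | no c≢w  = ⊥-elim (none (a , b , c , w , t , w∈ , a~w , b≢w , c≢w))

  isolable : ∀ S → (∀ u → ¬ Bad S u) → Isolable S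
  isolable S = go S (<-wellFounded _)
    where
    go : ∀ S → Acc _<_ ∣ S ∣ → (∀ u → ¬ Bad S u) → Isolable S
    go S (acc rec) good = Step.isolable-step S good (λ T T<S → go T (rec T<S))

-- The upper bound for connected graphs.

module _ (G : Graph (Fin n)) where
  open Graph G

  -- Irreflexivity of adjacency makes `f` injective and gives adjacent vertices distinct preimages.
  surjective-hom⇒≅ : (f : Fin 3 → Fin n) → (∀ i j → i ≢ j → f i ~ f j) →
                     (∀ v → ∃ λ i → f i ≡ v) → G ≅ K 3
  surjective-hom⇒≅ f hom surj = mk↔ₛ′ to f to∘f f∘to , λ u v → mk⇔
    (λ u~v to-eq → irrefl (trans (sym (f∘to u)) (trans (cong f to-eq) (f∘to v))) u~v)
    (λ to≢ → subst₂ _~_ (f∘to u) (f∘to v) (hom (to u) (to v) to≢))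
    where
    to = proj₁ ∘ surj
    f∘to : ∀ v → f (to v) ≡ v
    f∘to = proj₂ ∘ surj

    to∘f : ∀ i → to (f i) ≡ i
    to∘f i with to (f i) ≟ i
    ... | yes eq = eq
    ... | no  ≢i = ⊥-elim (irrefl (f∘to (f i)) (hom _ _ ≢i))

  -- A walk starting at `a` never leaves the triangle, so connectedness leaves no other vertex.
  connected-component⇒≅K₃ : ∀ {a b c} → Connected G → Component G ⊤ a b c → G ≅ K 3
  connected-component⇒≅K₃ {a} {b} {c} conn C =
    surjective-hom⇒≅ f hom (λ v → reach (zero , refl) (conn a v))
    where
    open Component C

    f : Fin 3 → Fin n
    f zero             = a
    f (suc zero)       = b
    f (suc (suc zero)) = c

    hom : ∀ i j → i ≢ j → f i ~ f j
    hom zero             zero             i≢j = ⊥-elim (i≢j refl)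
    hom zero             (suc zero)       _   = ab
    hom zero             (suc (suc zero)) _   = symm ca
    hom (suc zero)       zero             _   = symm ab
    hom (suc zero)       (suc zero)       i≢j = ⊥-elim (i≢j refl)
    hom (suc zero)       (suc (suc zero)) _   = bc
    hom (suc (suc zero)) zero             _   = ca
    hom (suc (suc zero)) (suc zero)       _   = symm bc
    hom (suc (suc zero)) (suc (suc zero)) i≢j = ⊥-elim (i≢j refl)

    step : ∀ i {w} → f i ~ w → ∃ λ j → f j ≡ w
    step zero             e = [ (λ eq → suc zero , sym eq) , (λ eq → suc (suc zero) , sym eq) ]′ (na _ ∈⊤ e)
    step (suc zero)       e = [ (λ eq → suc (suc zero) , sym eq) , (λ eq → zero , sym eq) ]′ (nb _ ∈⊤ e)
    step (suc (suc zero)) e = [ (λ eq → zero , sym eq) , (λ eq → suc zero , sym eq) ]′ (nc _ ∈⊤ e)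

    reach : ∀ {u v} → ∃ (λ i → f i ≡ u) → Star _~_ u v → ∃ λ i → f i ≡ v
    reach i          ε        = i
    reach (i , refl) (e ◅ es) = reach (step i e) es

  fromList-isolating : ∀ {ds} → Isolates G ⊤ ds → IsK₃Isolating G (fromList ds)
  fromList-isolating {ds} iso (f , _ , hom) =
    iso (triangle ∈⊤ ∈⊤ ∈⊤ (hom (λ ())) (hom (λ ())) (hom (λ ())))
        (undominated zero ∷ undominated (suc zero) ∷ undominated (suc (suc zero)) ∷ [])
    where
    undominated : ∀ i → All (λ d → ¬ Near G d (proj₁ (f i))) ds
    undominated i = All.tabulate λ d∈ds near → x∈∁p⇒x∉p (proj₂ (f i))
      (∈-comprehension (∈N[D]? G (fromList ds))
        (_ , ∈-fromList⁺ d∈ds , ∈-comprehension (∈N[v]? G _) near))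

  ι≤n/4 : Connected G → ¬ G ≅ K 3 → ι G ≤ n / 4
  ι≤n/4 conn G≇K₃ with isolable G ⊤ (λ _ (_ , _ , C) → G≇K₃ (connected-component⇒≅K₃ conn C))
  ... | ds , 4∣ds∣≤ , iso = begin
    ι G                 ≤⟨ proj₂ (proj₂ (smallest G)) _ (fromList ds , refl , fromList-isolating iso) ⟩
    ∣ fromList ds ∣     ≤⟨ ∣fromList∣≤length ds ⟩
    length ds           ≡⟨ m*n/n≡m (length ds) 4 ⟨
    length ds * 4 / 4   ≡⟨ cong (_/ 4) (ℕ.*-comm (length ds) 4) ⟩
    4 * length ds / 4   ≤⟨ /-monoˡ-≤ 4 4∣ds∣≤ ⟩
    ∣ ⊤ {n} ∣ / 4       ≡⟨ cong (_/ 4) (∣⊤∣≡n n) ⟩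
    n / 4               ∎
    where open ℕ.≤-Reasoning

-- Connectedness of paths and of the extremal graphs.

descent⇒connected : {V : Set} (G : Graph V) (root : V) (μ : V → ℕ) →
  (∀ v → v ≡ root ⊎ ∃ λ u → μ u < μ v × Adj G v u) → Connected G
descent⇒connected G root μ descend u v =
  to-root u (<-wellFounded _) ◅◅ reverse (Graph.symm G) (to-root v (<-wellFounded _))
  where
  to-root : ∀ v → Acc _<_ (μ v) → Star (Adj G) v root
  to-root v (acc rec) with descend v
  ... | inj₁ refl            = ε
  ... | inj₂ (u , u<v , v~u) = v~u ◅ to-root u (rec u<v)

connected-pullback : {V W : Set} (H : Graph W) (f : V → W) (g : W → V) →
  (∀ w → f (g w) ≡ w) → (∀ v → g (f v) ≡ v) → Connected H → Connected (pullback f H)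
connected-pullback H f g f∘g g∘f conn u v =
  subst₂ (Star _) (g∘f u) (g∘f v)
    (gmap g (λ {x} {y} → subst₂ (Adj H) (sym (f∘g x)) (sym (f∘g y))) (conn (f u) (f v)))

connected-Path : ∀ n → Connected (Path n)
connected-Path (suc n) = descent⇒connected (Path (suc n)) zero toℕ λ
  { zero    → inj₁ refl
  ; (suc i) → inj₂ (inject₁ i , s≤s (ℕ.≤-reflexive (toℕ-inject₁ i)) , bwd (cong suc (toℕ-inject₁ i)))
  }
connected-Path zero ()

connected-B⊎ : ∀ a b → 1 ≤ a → a ≤ b → Connected (B⊎ a b)
connected-B⊎ (suc a) (suc b) _ a<b = descent⇒connected (B⊎ (suc a) (suc b)) (inj₁ zero) μ descend
  where
  μ : Fin (suc b) ⊎ (Fin (suc a) × Fin 3) → ℕ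
  μ (inj₁ i)       = toℕ i
  -- One more than the path vertex joined to this triangle, so that stepping to it descends.
  μ (inj₂ (k , _)) = suc (toℕ k)

  descend : ∀ v → v ≡ inj₁ zero ⊎ ∃ λ u → μ u < μ v × Adj (B⊎ (suc a) (suc b)) v u
  descend (inj₁ zero)    = inj₁ refl
  descend (inj₁ (suc i)) with suc (toℕ i) <? suc a
  ... | yes i<a = inj₂ (inj₁ (inject₁ i) , s≤s (ℕ.≤-reflexive (toℕ-inject₁ i)) ,
    bwd (fwd (inj₁ (cong suc (toℕ-inject₁ i) , i<a))))
  -- There are `suc a` path vertices, so the one with index `a` is the last, to which all vertices
  -- beyond the path are joined.
  ... | no  i≮a = inj₂ (inj₁ (fromℕ< a<b) ,
    ℕ.≤-trans (s≤s (ℕ.≤-reflexive (toℕ-fromℕ< a<b))) a≤i ,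
    bwd (fwd (inj₂ (cong suc (toℕ-fromℕ< a<b) , a≤i))))
    where a≤i = ℕ.≮⇒≥ i≮a
  descend (inj₂ (k , _)) = inj₂ (inj₁ (inject≤ k a<b) ,
    s≤s (ℕ.≤-reflexive (toℕ-inject≤ k a<b)) , bwd (toℕ-inject≤ k a<b))

-- Numbering of the vertices and the lower bound by blocks.

module _ (n : ℕ) where
  private
    a b : ℕ
    a = n / 4
    b = n ∸ a * 3

    b+3a≡n : b + a * 3 ≡ n
    b+3a≡n = ℕ.m∸n+n≡m (ℕ.≤-trans (ℕ.*-monoʳ-≤ a (ℕ.n≤1+n 3)) (m/n*n≤m n 4))

  encode : Fin b ⊎ (Fin a × Fin 3) → Fin n
  encode = cast b+3a≡n ∘ join b (a * 3) ∘ map₂ (uncurry combine)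

  decode-encode : ∀ w → decode n (encode w) ≡ w
  decode-encode w = trans
    (cong (map₂ (remQuot 3)) (trans
      (cong (splitAt b) (cast-involutive (sym b+3a≡n) b+3a≡n (join b (a * 3) (map₂ (uncurry combine) w))))
      (splitAt-join b (a * 3) (map₂ (uncurry combine) w))))
    (remQuot-combine⊎ w)
    where
    remQuot-combine⊎ : ∀ w → map₂ (remQuot 3) (map₂ (uncurry combine) w) ≡ w
    remQuot-combine⊎ (inj₁ i)       = refl
    remQuot-combine⊎ (inj₂ (k , x)) = cong inj₂ (remQuot-combine k x)

  encode-decode : ∀ v → encode (decode n v) ≡ v
  encode-decode v = trans
    (cong (cast b+3a≡n) (trans
      (cong (join b (a * 3)) (combine-remQuot⊎ (splitAt b (cast (sym b+3a≡n) v))))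
      (join-splitAt b (a * 3) (cast (sym b+3a≡n) v))))
    (cast-involutive b+3a≡n (sym b+3a≡n) v)
    where
    combine-remQuot⊎ : ∀ w → map₂ (uncurry combine) (map₂ {A = Fin b} (remQuot {a} 3) w) ≡ w
    combine-remQuot⊎ (inj₁ i) = refl
    combine-remQuot⊎ (inj₂ j) = cong inj₂ (combine-remQuot {a} 3 j)

  connected-pullback-B⊎ : 4 ≤ n → Connected (pullback (decode n) (B⊎ a b))
  connected-pullback-B⊎ 4≤n = connected-pullback (B⊎ a b) (decode n) encode decode-encode encode-decode
    (connected-B⊎ a b (m≥n⇒m/n>0 4≤n) (ℕ.m+n≤o⇒m≤o∸n a (begin
      a + a * 3   ≡⟨ ℕ.*-suc a 3 ⟨
      a * 4       ≤⟨ m/n*n≤m n 4 ⟩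
      n           ∎)))
    where open ℕ.≤-Reasoning

  -- The index of the block {i} ∪ V(F i) containing a vertex; the vertices of P*
  -- beyond the first a get indices ≥ a.
  block : Fin b ⊎ (Fin a × Fin 3) → ℕ
  block (inj₁ i)       = toℕ i
  block (inj₂ (k , _)) = toℕ k

  -- Every vertex in the closed neighbourhood of a vertex of F k lies in block k. So `D` meets each
  -- block, as otherwise F k would survive; distinct blocks yield distinct elements of `D`.
  n/4≤∣isolating∣ : ∀ D → IsK₃Isolating (pullback (decode n) (B⊎ a b)) D → a ≤ ∣ D ∣
  n/4≤∣isolating∣ D iso = begin
    a                                        ≡⟨ length-tabulate (proj₁ ∘ hit) ⟨
    length (tabulate (proj₁ ∘ hit))          ≤⟨ ℕ.m≤m+n _ ∣ ⊥ {n} ∣ ⟩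
    length (tabulate (proj₁ ∘ hit)) + ∣ ⊥ {n} ∣
      ≤⟨ length+∣p∣≤∣q∣ (tabulate (proj₁ ∘ hit)) (Unique.tabulate⁺ hit-injective)
           (AllP.tabulate⁺ (λ k → proj₁ (proj₂ (hit k)) , ∉⊥)) (⊥-elim ∘ ∉⊥) ⟩
    ∣ D ∣                                    ∎
    where
    open ℕ.≤-Reasoning
    H = pullback (decode n) (B⊎ a b)

    adjacent⇒same-block : ∀ v {k x} → Adj (B⊎ a b) v (inj₂ (k , x)) → block v ≡ toℕ k
    adjacent⇒same-block (inj₁ i) (fwd eq)         = eq
    adjacent⇒same-block (inj₂ _) (fwd (refl , _)) = refl
    adjacent⇒same-block (inj₂ _) (bwd (refl , _)) = refl

    near⇒same-block : ∀ {v k x} → Near H v (encode (inj₂ (k , x))) → block (decode n v) ≡ toℕ k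
    near⇒same-block {k = k} {x} (inj₁ refl) = cong block (decode-encode (inj₂ (k , x)))
    near⇒same-block {v} {k} {x} (inj₂ e) =
      adjacent⇒same-block (decode n v) (subst (Adj (B⊎ a b) (decode n v)) (decode-encode (inj₂ (k , x))) e)

    hit : ∀ k → ∃ λ v → v ∈ D × block (decode n v) ≡ toℕ k
    hit k with any? (λ v → (v ∈? D) ×-dec (block (decode n v) ℕ.≟ toℕ k))
    ... | yes found = found
    ... | no  none  = ⊥-elim (iso (f , f-injective , λ {x} {y} x≢y →
      subst₂ (Adj (B⊎ a b)) (sym (decode-encode (inj₂ (k , x)))) (sym (decode-encode (inj₂ (k , y))))
        (fwd (refl , x≢y))))
      where
      f : Fin 3 → Σ (Fin n) (_∈ ∁ (N[D] H D))
      f x = encode (inj₂ (k , x)) , x∉p⇒x∈∁p λ x∈ →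
        case ∈-comprehension⁻ (∈N[D]? H D) x∈ of λ (v , v∈D , x∈N) →
          none (v , v∈D , near⇒same-block {v} (∈-comprehension⁻ (∈N[v]? H v) x∈N))

      f-injective : Injective _≡_ _≡_ f
      f-injective {x} {y} eq = ,-injectiveʳ (inj₂-injective (trans (sym (decode-encode (inj₂ (k , x))))
        (trans (cong (decode n ∘ proj₁) eq) (decode-encode (inj₂ (k , y))))))

    hit-injective : ∀ {k l} → proj₁ (hit k) ≡ proj₁ (hit l) → k ≡ l
    hit-injective {k} {l} eq = toℕ-injective (trans (sym (proj₂ (proj₂ (hit k))))
      (trans (cong (block ∘ decode n) eq) (proj₂ (proj₂ (hit l)))))

-- The graphs `B n` attain the bound.

connected-B : ∀ n → Connected (B n)
connected-B n with n ≤? 3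
... | yes _   = connected-Path n
... | no  n≰3 = connected-pullback-B⊎ n (ℕ.≰⇒> n≰3)

-- An isomorphism forces `n` to be 3, and then `B n` is a path whose two ends are not adjacent.
B≇K₃ : ∀ n → ¬ B n ≅ K 3
B≇K₃ n iso@(f , _) with ↔⇒≡ f
... | refl = case Equivalence.from (proj₂ iso zero (suc (suc zero))) to≢ of λ
  { (fwd ()) ; (bwd ()) }
  where
  to≢ : Inverse.to f zero ≢ Inverse.to f (suc (suc zero))
  to≢ eq = case trans (sym (Inverse.strictlyInverseʳ f zero))
    (trans (cong (Inverse.from f) eq) (Inverse.strictlyInverseʳ f (suc (suc zero)))) of λ ()

≤ι : ∀ {n m} (G : Graph (Fin n)) → (∀ D → IsK₃Isolating G D → m ≤ ∣ D ∣) → m ≤ ι G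
≤ι {m = m} G bound = go (proj₁ (proj₂ (smallest G)))
  where
  go : ∀ {k} → K₃IsolatingSize G k → m ≤ k
  go (D , refl , iso) = bound D iso

n/4≤∣isolating-B∣ : ∀ n D → IsK₃Isolating (B n) D → n / 4 ≤ ∣ D ∣
n/4≤∣isolating-B∣ n D iso with n ≤? 3
... | yes n≤3 = ℕ.≤-trans (ℕ.≤-reflexive (m<n⇒m/n≡0 (s≤s n≤3))) z≤n
... | no  _   = n/4≤∣isolating∣ n D iso

theorem1p3 : (n : ℕ) → 1 ≤ n → IsιMax n (ι (B n)) × ι (B n) ≡ n / 4
theorem1p3 n _ =
  ( (B n , connected-B n , B≇K₃ n , refl)
  , λ { _ (G , conn , G≇K₃ , refl) → subst (ι G ≤_) (sym ιB≡n/4) (ι≤n/4 G conn G≇K₃) })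
  , ιB≡n/4
  where
  ιB≡n/4 : ι (B n) ≡ n / 4
  ιB≡n/4 = ℕ.≤-antisym (ι≤n/4 (B n) (connected-B n) (B≇K₃ n)) (≤ι (B n) (n/4≤∣isolating-B∣ n))
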